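{- Each of the following 47 varieties is equal to $\mathcal{SL}$: $\mathcal{A}_{13}$, $\mathcal{A}_{14}$, $\mathcal{A}_{15}$, $\mathcal{A}_{24}$, $\mathcal{A}_{34}$, $\mathcal{A}_{45}$, $\mathcal{B}_{12}$, $\mathcal{B}_{14}$, $\mathcal{B}_{15}$, $\mathcal{B}_{23}$, $\mathcal{B}_{24}$, $\mathcal{B}_{34}$, $\mathcal{B}_{35}$, $\mathcal{B}_{45}$, $\mathcal{C}_{12}$, $\mathcal{C}_{13}$, $\mathcal{C}_{14}$, $\mathcal{C}_{15}$, $\mathcal{C}_{23}$, $\mathcal{C}_{24}$, $\mathcal{C}_{34}$, $\mathcal{C}_{35}$, $\mathcal{C}_{45}$, $\mathcal{D}_{13}$, $\mathcal{D}_{14}$, $\mathcal{D}_{15}$, $\mathcal{D}_{23}$, $\mathcal{D}_{24}$, $\mathcal{D}_{34}$, $\mathcal{D}_{45}$, $\mathcal{E}_{12}$, $\mathcal{E}_{13}$, $\mathcal{E}_{14}$, $\mathcal{E}_{15}$, $\mathcal{E}_{23}$, $\mathcal{E}_{24}$, $\mathcal{E}_{34}$, $\mathcal{E}_{35}$, $\mathcal{E}_{45}$, $\mathcal{F}_{12}$, $\mathcal{F}_{14}$, $\mathcal{F}_{15}$, $\mathcal{F}_{23}$, $\mathcal{F}_{24}$, $\mathcal{F}_{34}$, $\mathcal{F}_{35}$, $\mathcal{F}_{45}$.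
   Context: A zroupoid is an algebra $\langle A,\to,0\rangle$ with $\to$ binary and $0$ a constant; write $x' := x\to 0$. An implication zroupoid ($\mathcal I$-zroupoid) is a zroupoid satisfying (I) $(x\to y)\to z \approx ((z'\to x)\to(y\to z)')'$ and (I$_0$) $0''\approx 0$. Let $\mathcal S$ be the variety of $\mathcal I$-zroupoids satisfying $x''\approx x$ and $(x\to y')'\approx (y\to x')'$ (symmetric $\mathcal I$-zroupoids). $\mathcal{SL}$ is the variety of $\mathcal I$-zroupoids satisfying $x'\approx x$ and $x\to y\approx y\to x$. Identities of Bol-Moufang type: consider the six words in variables $x,y,z$: A: $xxyz$, B: $xyxz$, C: $xyyz$, D: $xyzx$, E: $xyzy$, F: $xyzz$, and the five bracketings of a word $o_1o_2o_3o_4$ of length 4 with $\to$: 1: $o_1\to(o_2\to(o_3\to o_4))$; 2: $o_1\to((o_2\to o_3)\to o_4)$; 3: $(o_1\to o_2)\to(o_3\to o_4)$; 4: $(o_1\to(o_2\to o_3))\to o_4$; 5: $((o_1\to o_2)\to o_3)\to o_4$. For $X\in\{A,\dots,F\}$ and $1\le i<j\le 5$, $(X_{ij})$ is the identity whose left side is word $X$ bracketed by $i$ and whose right side is word $X$ bracketed by $j$ (e.g. $(A_{12})$: $x\to(x\to(y\to z))\approx x\to((x\to y)\to z)$). $\mathcal X_{ij}$ denotes the subvariety of $\mathcal S$ defined by $(X_{ij})$. -}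

module Defs where

open import Level using (Level; suc)
open import Data.Product using (_×_; _,_)
open import Data.List using (List; _∷_; [])
open import Relation.Binary.PropositionalEquality using (_≡_)

record Zroupoid (ℓ : Level) : Set (suc ℓ) where
  infixr 5 _⇒_
  field
    Carrier : Set ℓ
    _⇒_     : Carrier → Carrier → Carrier
    𝟘       : Carrier

  _′ : Carrier → Carrier
  x ′ = x ⇒ 𝟘

module _ {ℓ : Level} (Z : Zroupoid ℓ) where
  open Zroupoid Z

  record IsIZroupoid : Set ℓ where
    field
      axI  : ∀ x y z → (x ⇒ y) ⇒ z ≡ ((((z ′) ⇒ x) ⇒ ((y ⇒ z) ′)) ′)
      axI₀ : (𝟘 ′) ′ ≡ 𝟘

  record InS : Set ℓ where
    field
      isI   : IsIZroupoid
      invol : ∀ x → (x ′) ′ ≡ x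
      symm  : ∀ x y → (x ⇒ (y ′)) ′ ≡ (y ⇒ (x ′)) ′

  record InSL : Set ℓ where
    field
      isI  : IsIZroupoid
      prim : ∀ x → x ′ ≡ x
      comm : ∀ x y → x ⇒ y ≡ y ⇒ x

data Letter : Set where
  A B C D E F : Letter

data Br : Set where
  b1 b2 b3 b4 b5 : Br

module _ {ℓ : Level} (Z : Zroupoid ℓ) where
  open Zroupoid Z

  bracket : Br → Carrier → Carrier → Carrier → Carrier → Carrier
  bracket b1 o₁ o₂ o₃ o₄ = o₁ ⇒ (o₂ ⇒ (o₃ ⇒ o₄))
  bracket b2 o₁ o₂ o₃ o₄ = o₁ ⇒ ((o₂ ⇒ o₃) ⇒ o₄)
  bracket b3 o₁ o₂ o₃ o₄ = (o₁ ⇒ o₂) ⇒ (o₃ ⇒ o₄)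
  bracket b4 o₁ o₂ o₃ o₄ = (o₁ ⇒ (o₂ ⇒ o₃)) ⇒ o₄
  bracket b5 o₁ o₂ o₃ o₄ = ((o₁ ⇒ o₂) ⇒ o₃) ⇒ o₄

  term : Letter → Br → Carrier → Carrier → Carrier → Carrier
  term A i x y z = bracket i x x y z
  term B i x y z = bracket i x y x z
  term C i x y z = bracket i x y y z
  term D i x y z = bracket i x y z x
  term E i x y z = bracket i x y z y
  term F i x y z = bracket i x y z z

  Satisfies : Letter → Br → Br → Set ℓ
  Satisfies X i j = ∀ x y z → term X i x y z ≡ term X j x y z

theorem3p7-list : List (Letter × Br × Br)
theorem3p7-list =
  (A , b1 , b3) ∷ (A , b1 , b4) ∷ (A , b1 , b5) ∷ (A , b2 , b4) ∷ (A , b3 , b4) ∷ (A , b4 , b5) ∷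
  (B , b1 , b2) ∷ (B , b1 , b4) ∷ (B , b1 , b5) ∷ (B , b2 , b3) ∷ (B , b2 , b4) ∷ (B , b3 , b4) ∷ (B , b3 , b5) ∷ (B , b4 , b5) ∷
  (C , b1 , b2) ∷ (C , b1 , b3) ∷ (C , b1 , b4) ∷ (C , b1 , b5) ∷ (C , b2 , b3) ∷ (C , b2 , b4) ∷ (C , b3 , b4) ∷ (C , b3 , b5) ∷ (C , b4 , b5) ∷
  (D , b1 , b3) ∷ (D , b1 , b4) ∷ (D , b1 , b5) ∷ (D , b2 , b3) ∷ (D , b2 , b4) ∷ (D , b3 , b4) ∷ (D , b4 , b5) ∷
  (E , b1 , b2) ∷ (E , b1 , b3) ∷ (E , b1 , b4) ∷ (E , b1 , b5) ∷ (E , b2 , b3) ∷ (E , b2 , b4) ∷ (E , b3 , b4) ∷ (E , b3 , b5) ∷ (E , b4 , b5) ∷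
  (F , b1 , b2) ∷ (F , b1 , b4) ∷ (F , b1 , b5) ∷ (F , b2 , b3) ∷ (F , b2 , b4) ∷ (F , b3 , b4) ∷ (F , b3 , b5) ∷ (F , b4 , b5) ∷
  []

{-# OPTIONS --safe #-}

-- Put x ⊓ y = (x ⇒ y ′) ′ and x ⊔ y = x ′ ⇒ y.  Symmetric I-zroupoids are then
-- commutative, mutually distributive pairs of operations with units 𝟘 ′ and 𝟘,
-- exchanged by the involution ′.  In such an algebra {𝟘 , 𝟘 ′} is a homomorphic
-- image of the two-element Boolean algebra 𝟚, so an identity failing in 𝟚 forces
-- 𝟘 ′ ≡ 𝟘.  Once 𝟘 ′ ≡ 𝟘, distributivity gives x ⊓ y ≡ x ⊔ y, and
-- {𝟘 , x , x ′ , x ⇒ x} is a homomorphic image of the free one-generated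
-- involutive semilattice 𝟜; identifying any two distinct elements of 𝟜 forces
-- x ′ ≡ x.  Hence an identity failing in both 𝟚 and 𝟜 defines SL within S, and
-- each of the 47 identities does fail in both.  Conversely, ⇒ is associative
-- in SL.
module Submission where

open import Defs
open import Level using (Level; 0ℓ)
open import Data.Bool using (Bool; true; false; not; _∨_)
open import Data.Bool.Properties using () renaming (_≟_ to _≟ᵇ_)
open import Data.Empty using (⊥-elim)
open import Data.List using (List; _∷_; []; cartesianProduct)
open import Data.List.Membership.Propositional using (_∈_)
open import Data.List.Relation.Unary.All using (All; all?; lookup)
open import Data.List.Relation.Unary.Any using (Any; any?; satisfied)
open import Data.Product using (_×_; _,_; ∃)
open import Data.Product.Properties using (≡-dec)
open import Function.Bundles using (_⇔_; mk⇔)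
open import Relation.Binary.Definitions using (DecidableEquality)
open import Relation.Binary.PropositionalEquality using (_≡_; _≢_; refl; sym; trans; cong; cong₂; module ≡-Reasoning)
open import Relation.Nullary using (Dec; ¬?)
open import Relation.Nullary.Decidable using (from-yes)

open ≡-Reasoning

-- Transfer of identities along a map that preserves `⇒`.

module Homomorphism {a b : Level} (M : Zroupoid a) (N : Zroupoid b)
  (h : Zroupoid.Carrier M → Zroupoid.Carrier N)
  (h-⇒ : ∀ s t → h (Zroupoid._⇒_ M s t) ≡ Zroupoid._⇒_ N (h s) (h t)) where

  private
    module M = Zroupoid M
    module N = Zroupoid N

    homˡ : ∀ {s u} t → h s ≡ u → h (s M.⇒ t) ≡ u N.⇒ h t
    homˡ t e = trans (h-⇒ _ t) (cong (N._⇒ h t) e)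

    homʳ : ∀ s {t u} → h t ≡ u → h (s M.⇒ t) ≡ h s N.⇒ u
    homʳ s e = trans (h-⇒ s _) (cong (h s N.⇒_) e)

  h-bracket : ∀ i p q r s → h (bracket M i p q r s) ≡ bracket N i (h p) (h q) (h r) (h s)
  h-bracket b1 p q r s = homʳ p (homʳ q (h-⇒ r s))
  h-bracket b2 p q r s = homʳ p (homˡ s (h-⇒ q r))
  h-bracket b3 p q r s = trans (h-⇒ _ _) (cong₂ N._⇒_ (h-⇒ p q) (h-⇒ r s))
  h-bracket b4 p q r s = homˡ s (homʳ p (h-⇒ q r))
  h-bracket b5 p q r s = homˡ s (homˡ r (h-⇒ p q))

  h-term : ∀ X i p q r → h (term M X i p q r) ≡ term N X i (h p) (h q) (h r)
  h-term A i p q r = h-bracket i p p q r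
  h-term B i p q r = h-bracket i p q p r
  h-term C i p q r = h-bracket i p q q r
  h-term D i p q r = h-bracket i p q r p
  h-term E i p q r = h-bracket i p q r q
  h-term F i p q r = h-bracket i p q r r

  identity-transfer : ∀ {X i j} → Satisfies N X i j → ∀ p q r → h (term M X i p q r) ≡ h (term M X j p q r)
  identity-transfer {X} {i} {j} sat p q r =
    trans (h-term X i p q r) (trans (sat (h p) (h q) (h r)) (sym (h-term X j p q r)))

-- The two finite test algebras and the search for failing assignments.

𝟚 : Zroupoid 0ℓ
𝟚 = record { Carrier = Bool ; _⇒_ = λ a b → not a ∨ b ; 𝟘 = false }

-- (p , q) stands for the meet of those of x, x ′ selected by p, q; here s ⇒ t is
-- the meet of s ′ and t.
𝟜 : Zroupoid 0ℓ
𝟜 = record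
  { Carrier = Bool × Bool
  ; _⇒_     = λ { (p , q) (r , s) → (q ∨ r , p ∨ s) }
  ; 𝟘       = (false , false)
  }

-- Uncurried over triples, so that a search through a cartesian product yields a witness directly.
Separates : ∀ {ℓ} (M : Zroupoid ℓ) → Letter × Br × Br → (let K = Zroupoid.Carrier M) → K × K × K → Set ℓ
Separates M (X , i , j) (x , y , z) = term M X i x y z ≢ term M X j x y z

module Refutation {ℓ : Level} (M : Zroupoid ℓ) (_≟_ : DecidableEquality (Zroupoid.Carrier M))
  (elements : List (Zroupoid.Carrier M)) where

  Refuted : Letter × Br × Br → Set ℓ
  Refuted t = Any (Separates M t) (cartesianProduct elements (cartesianProduct elements elements))

  refuted? : ∀ t → Dec (Refuted t)
  refuted? (X , i , j) = any? (λ { (x , y , z) → ¬? (term M X i x y z ≟ term M X j x y z) }) _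

bools : List Bool
bools = true ∷ false ∷ []

module R₂ = Refutation 𝟚 _≟ᵇ_ bools
module R₄ = Refutation 𝟜 (≡-dec _≟ᵇ_ _≟ᵇ_) (cartesianProduct bools bools)

-- Settled by evaluation during type checking: eight assignments per identity here, and 64 for `𝟜`.
all-refuted-𝟚 : All R₂.Refuted theorem3p7-list
all-refuted-𝟚 = from-yes (all? R₂.refuted? theorem3p7-list)

all-refuted-𝟜 : All R₄.Refuted theorem3p7-list
all-refuted-𝟜 = from-yes (all? R₄.refuted? theorem3p7-list)

-- Symmetric algebras: two operations, and the image of `𝟚`.

module Symmetric {ℓ : Level} (Z : Zroupoid ℓ) (inS : InS Z) where
  open Zroupoid Z
  open InS inS
  open IsIZroupoid isI

  infixr 6 _⊓_ _⊔_

  _⊓_ _⊔_ : Carrier → Carrier → Carrier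
  x ⊓ y = (x ⇒ y ′) ′
  x ⊔ y = x ′ ⇒ y

  ⇒-exchange : ∀ x y → x ⇒ y ′ ≡ y ⇒ x ′
  ⇒-exchange x y = trans (sym (invol _)) (trans (cong _′ (symm x y)) (invol _))

  contrapositive : ∀ x y → x ⇒ y ≡ y ′ ⇒ x ′
  contrapositive x y = trans (cong (x ⇒_) (sym (invol y))) (⇒-exchange x (y ′))

  ⊓-comm : ∀ x y → x ⊓ y ≡ y ⊓ x
  ⊓-comm = symm

  ⊔-comm : ∀ x y → x ⊔ y ≡ y ⊔ x
  ⊔-comm x y = trans (contrapositive (x ′) y) (cong (y ′ ⇒_) (invol x))

  ′-⊓ : ∀ x y → (x ⊓ y) ′ ≡ x ′ ⊔ y ′
  ′-⊓ x y = trans (invol _) (cong (_⇒ y ′) (sym (invol x)))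

  ′-⊔ : ∀ x y → (x ⊔ y) ′ ≡ x ′ ⊓ y ′
  ′-⊔ x y = cong (λ w → (x ′ ⇒ w) ′) (sym (invol y))

  -- This is `axI` at `x`, `y ′`, `z`, read through the definitions of `⊓` and `⊔`.
  ⊔-distrib-⊓ : ∀ x y z → (x ⊓ y) ⊔ z ≡ (x ⊔ z) ⊓ (y ⊔ z)
  ⊔-distrib-⊓ x y z = begin
    ((x ⇒ y ′) ′) ′ ⇒ z  ≡⟨ cong (_⇒ z) (invol _) ⟩
    (x ⇒ y ′) ⇒ z        ≡⟨ axI x (y ′) z ⟩
    (z ⊔ x) ⊓ (y ⊔ z)    ≡⟨ cong (_⊓ (y ⊔ z)) (⊔-comm z x) ⟩
    (x ⊔ z) ⊓ (y ⊔ z)    ∎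

  -- De Morgan dual of `⊔-distrib-⊓`, conjugated by the involution.
  ⊓-distrib-⊔ : ∀ x y z → (x ⊔ y) ⊓ z ≡ (x ⊓ z) ⊔ (y ⊓ z)
  ⊓-distrib-⊔ x y z = begin
    (x ⊔ y) ⊓ z                        ≡⟨ invol _ ⟨
    (((x ⊔ y) ⊓ z) ′) ′                ≡⟨ cong _′ (′-⊓ _ z) ⟩
    ((x ⊔ y) ′ ⊔ z ′) ′                ≡⟨ cong (λ w → (w ⊔ z ′) ′) (′-⊔ x y) ⟩
    ((x ′ ⊓ y ′) ⊔ z ′) ′              ≡⟨ cong _′ (⊔-distrib-⊓ (x ′) (y ′) (z ′)) ⟩
    ((x ′ ⊔ z ′) ⊓ (y ′ ⊔ z ′)) ′      ≡⟨ cong _′ (cong₂ _⊓_ (′-⊓ x z) (′-⊓ y z)) ⟨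
    ((x ⊓ z) ′ ⊓ (y ⊓ z) ′) ′          ≡⟨ cong _′ (′-⊔ (x ⊓ z) (y ⊓ z)) ⟨
    (((x ⊓ z) ⊔ (y ⊓ z)) ′) ′          ≡⟨ invol _ ⟩
    (x ⊓ z) ⊔ (y ⊓ z)                  ∎

  ⊓-identityʳ : ∀ x → x ⊓ 𝟘 ′ ≡ x
  ⊓-identityʳ x = trans (cong (λ w → (x ⇒ w) ′) axI₀) (invol x)

  ⊔-identityʳ : ∀ x → x ⊔ 𝟘 ≡ x
  ⊔-identityʳ = invol

  ⊔-identityˡ : ∀ x → 𝟘 ⊔ x ≡ x
  ⊔-identityˡ x = trans (⊔-comm 𝟘 x) (⊔-identityʳ x)

  -- The only entry in the table of `𝟚` that needs distributivity; both units are inserted so that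
  -- it applies.
  𝟘′-⊔-idem : 𝟘 ′ ⊔ 𝟘 ′ ≡ 𝟘 ′
  𝟘′-⊔-idem = sym (begin
    𝟘 ′                                ≡⟨ ⊔-identityˡ _ ⟨
    𝟘 ⊔ 𝟘 ′                            ≡⟨ cong (_⊔ 𝟘 ′) (⊓-identityʳ 𝟘) ⟨
    (𝟘 ⊓ 𝟘 ′) ⊔ 𝟘 ′                    ≡⟨ ⊔-distrib-⊓ 𝟘 (𝟘 ′) (𝟘 ′) ⟩
    (𝟘 ⊔ 𝟘 ′) ⊓ (𝟘 ′ ⊔ 𝟘 ′)            ≡⟨ cong (_⊓ (𝟘 ′ ⊔ 𝟘 ′)) (⊔-identityˡ _) ⟩
    𝟘 ′ ⊓ (𝟘 ′ ⊔ 𝟘 ′)                  ≡⟨ ⊓-comm _ _ ⟩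
    (𝟘 ′ ⊔ 𝟘 ′) ⊓ 𝟘 ′                  ≡⟨ ⊓-identityʳ _ ⟩
    𝟘 ′ ⊔ 𝟘 ′                          ∎)

  fromBool : Bool → Carrier
  fromBool false = 𝟘
  fromBool true  = 𝟘 ′

  fromBool-⇒ : ∀ a b → fromBool (not a ∨ b) ≡ fromBool a ⇒ fromBool b
  fromBool-⇒ false false = refl
  -- By `axI₀`, `𝟘 ⇒ 𝟘 ′` is `𝟘 ′ ⊔ 𝟘 ′`.
  fromBool-⇒ false true  = sym (trans (cong (_⇒ 𝟘 ′) (sym axI₀)) 𝟘′-⊔-idem)
  fromBool-⇒ true  b     = sym (⊔-identityˡ (fromBool b))

  fromBool-collapse : ∀ a b → a ≢ b → fromBool a ≡ fromBool b → 𝟘 ′ ≡ 𝟘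
  fromBool-collapse false false a≢b _ = ⊥-elim (a≢b refl)
  fromBool-collapse false true  _   e = sym e
  fromBool-collapse true  false _   e = e
  fromBool-collapse true  true  a≢b _ = ⊥-elim (a≢b refl)

  𝟚-refuted⇒𝟘′≡𝟘 : ∀ {X i j} → Satisfies Z X i j → ∃ (Separates 𝟚 (X , i , j)) → 𝟘 ′ ≡ 𝟘
  𝟚-refuted⇒𝟘′≡𝟘 {X} {i} {j} sat ((p , q , r) , ne) =
    fromBool-collapse _ _ ne (Homomorphism.identity-transfer 𝟚 Z fromBool fromBool-⇒ {X} {i} {j} sat p q r)

  -- The case `𝟘 ′ ≡ 𝟘`: one common unit, and the two operations coincide.

  module ZeroIsOne (𝟘′≡𝟘 : 𝟘 ′ ≡ 𝟘) where

    ⊓-identityˡ-𝟘 : ∀ x → 𝟘 ⊓ x ≡ x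
    ⊓-identityˡ-𝟘 x = trans (⊓-comm 𝟘 x) (trans (cong (x ⊓_) (sym 𝟘′≡𝟘)) (⊓-identityʳ x))

    ⊓-idem : ∀ x → x ⊓ x ≡ x
    ⊓-idem x = begin
      x ⊓ x                ≡⟨ cong₂ _⊓_ (⊔-identityˡ x) (⊔-identityˡ x) ⟨
      (𝟘 ⊔ x) ⊓ (𝟘 ⊔ x)    ≡⟨ ⊔-distrib-⊓ 𝟘 𝟘 x ⟨
      (𝟘 ⊓ 𝟘) ⊔ x          ≡⟨ cong (_⊔ x) (⊓-identityˡ-𝟘 𝟘) ⟩
      𝟘 ⊔ x                ≡⟨ ⊔-identityˡ x ⟩
      x                    ∎

    ⊔-idem : ∀ x → x ⊔ x ≡ x
    ⊔-idem x = begin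
      x ⊔ x                ≡⟨ cong₂ _⊔_ (⊓-identityˡ-𝟘 x) (⊓-identityˡ-𝟘 x) ⟨
      (𝟘 ⊓ x) ⊔ (𝟘 ⊓ x)    ≡⟨ ⊓-distrib-⊔ 𝟘 𝟘 x ⟨
      (𝟘 ⊔ 𝟘) ⊓ x          ≡⟨ cong (_⊓ x) (⊔-identityˡ 𝟘) ⟩
      𝟘 ⊓ x                ≡⟨ ⊓-identityˡ-𝟘 x ⟩
      x                    ∎

    -- Distribute `⊔ z` over `𝟘 ⊓ x`, which is just `x`. In terms of `⊓`, the element `x ⊔ z` lies
    -- below `z`.
    ⊔-below-⊓ : ∀ x z → z ⊓ (x ⊔ z) ≡ x ⊔ z
    ⊔-below-⊓ x z = begin
      z ⊓ (x ⊔ z)          ≡⟨ cong (_⊓ (x ⊔ z)) (⊔-identityˡ z) ⟨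
      (𝟘 ⊔ z) ⊓ (x ⊔ z)    ≡⟨ ⊔-distrib-⊓ 𝟘 x z ⟨
      (𝟘 ⊓ x) ⊔ z          ≡⟨ cong (_⊔ z) (⊓-identityˡ-𝟘 x) ⟩
      x ⊔ z                ∎

    ⊓-below-⊔ : ∀ x z → z ⊔ (x ⊓ z) ≡ x ⊓ z
    ⊓-below-⊔ x z = begin
      z ⊔ (x ⊓ z)          ≡⟨ cong (_⊔ (x ⊓ z)) (⊓-identityˡ-𝟘 z) ⟨
      (𝟘 ⊓ z) ⊔ (x ⊓ z)    ≡⟨ ⊓-distrib-⊔ 𝟘 x z ⟨
      (𝟘 ⊔ x) ⊓ z          ≡⟨ cong (_⊓ z) (⊔-identityˡ x) ⟩
      x ⊓ z                ∎

    -- Since `x ⊔ z` is its own `⊓` with `z`, `⊓-below-⊔` applies to it.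
    ⊔-absorb : ∀ x z → z ⊔ (x ⊔ z) ≡ x ⊔ z
    ⊔-absorb x z = begin
      z ⊔ (x ⊔ z)          ≡⟨ cong (z ⊔_) (trans (⊓-comm _ z) (⊔-below-⊓ x z)) ⟨
      z ⊔ ((x ⊔ z) ⊓ z)    ≡⟨ ⊓-below-⊔ (x ⊔ z) z ⟩
      (x ⊔ z) ⊓ z          ≡⟨ trans (⊓-comm _ z) (⊔-below-⊓ x z) ⟩
      x ⊔ z                ∎

    ⊓-absorb : ∀ x z → z ⊓ (x ⊓ z) ≡ x ⊓ z
    ⊓-absorb x z = begin
      z ⊓ (x ⊓ z)          ≡⟨ cong (z ⊓_) (trans (⊔-comm _ z) (⊓-below-⊔ x z)) ⟨
      z ⊓ ((x ⊓ z) ⊔ z)    ≡⟨ ⊔-below-⊓ (x ⊓ z) z ⟩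
      (x ⊓ z) ⊔ z          ≡⟨ trans (⊔-comm _ z) (⊓-below-⊔ x z) ⟩
      x ⊓ z                ∎

    -- After distributing, both factors collapse to `x ⊔ z` by absorption.
    ⊓⊔-⊔ : ∀ x z → (x ⊓ z) ⊔ (x ⊔ z) ≡ x ⊔ z
    ⊓⊔-⊔ x z = begin
      (x ⊓ z) ⊔ (x ⊔ z)                ≡⟨ ⊔-distrib-⊓ x z (x ⊔ z) ⟩
      (x ⊔ (x ⊔ z)) ⊓ (z ⊔ (x ⊔ z))    ≡⟨ cong₂ _⊓_ (cong (x ⊔_) (⊔-comm x z)) (⊔-absorb x z) ⟩
      (x ⊔ (z ⊔ x)) ⊓ (x ⊔ z)          ≡⟨ cong (_⊓ (x ⊔ z)) (trans (⊔-absorb z x) (⊔-comm z x)) ⟩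
      (x ⊔ z) ⊓ (x ⊔ z)                ≡⟨ ⊓-idem _ ⟩
      x ⊔ z                            ∎

    ⊔⊓-⊓ : ∀ x z → (x ⊔ z) ⊓ (x ⊓ z) ≡ x ⊓ z
    ⊔⊓-⊓ x z = begin
      (x ⊔ z) ⊓ (x ⊓ z)                ≡⟨ ⊓-distrib-⊔ x z (x ⊓ z) ⟩
      (x ⊓ (x ⊓ z)) ⊔ (z ⊓ (x ⊓ z))    ≡⟨ cong₂ _⊔_ (cong (x ⊓_) (⊓-comm x z)) (⊓-absorb x z) ⟩
      (x ⊓ (z ⊓ x)) ⊔ (x ⊓ z)          ≡⟨ cong (_⊔ (x ⊓ z)) (trans (⊓-absorb z x) (⊓-comm z x)) ⟩
      (x ⊓ z) ⊔ (x ⊓ z)                ≡⟨ ⊔-idem _ ⟩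
      x ⊓ z                            ∎

    -- With u = `x ⊓ z` and v = `x ⊔ z`, the two preceding lemmas give v ⊔ u = v and u ⊓ v = u,
    -- while `⊔-below-⊓` gives u ⊓ (v ⊔ u) = v ⊔ u. Hence u = v.
    ⊓≡⊔ : ∀ x z → x ⊓ z ≡ x ⊔ z
    ⊓≡⊔ x z = begin
      x ⊓ z                            ≡⟨ ⊔⊓-⊓ x z ⟨
      (x ⊔ z) ⊓ (x ⊓ z)                ≡⟨ ⊓-comm _ _ ⟩
      (x ⊓ z) ⊓ (x ⊔ z)                ≡⟨ cong ((x ⊓ z) ⊓_) ⊔⊓-⊔ ⟨
      (x ⊓ z) ⊓ ((x ⊔ z) ⊔ (x ⊓ z))    ≡⟨ ⊔-below-⊓ (x ⊔ z) (x ⊓ z) ⟩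
      (x ⊔ z) ⊔ (x ⊓ z)                ≡⟨ ⊔⊓-⊔ ⟩
      x ⊔ z                            ∎
      where
      ⊔⊓-⊔ : (x ⊔ z) ⊔ (x ⊓ z) ≡ x ⊔ z
      ⊔⊓-⊔ = trans (⊔-comm _ _) (⊓⊔-⊔ x z)

    -- As `⊓` and `⊔` agree, De Morgan duality turns `′` into an automorphism.
    ′-⇒ : ∀ x y → (x ⇒ y) ′ ≡ x ′ ⇒ y ′
    ′-⇒ x y = begin
      (x ⇒ y) ′        ≡⟨ cong (λ w → (x ⇒ w) ′) (invol y) ⟨
      x ⊓ y ′          ≡⟨ ⊓≡⊔ x (y ′) ⟩
      x ′ ⇒ y ′        ∎

    ⇒-self-′ : ∀ x → (x ⇒ x) ′ ≡ x ⇒ x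
    ⇒-self-′ x = trans (′-⇒ x x) (sym (contrapositive x x))

    -- Here `x ⇒ x` is the join of `x` and `x ′`, so this is an instance of `⊔-absorb`.
    ⇒-absorbˡ : ∀ x → x ⇒ (x ⇒ x) ≡ x ⇒ x
    ⇒-absorbˡ x = begin
      x ⇒ (x ⇒ x)        ≡⟨ cong₂ _⇒_ (invol x) (trans (⊔-comm x (x ′)) (cong (_⇒ x) (invol x))) ⟨
      x ′ ⊔ (x ⊔ x ′)    ≡⟨ ⊔-absorb x (x ′) ⟩
      x ⊔ x ′            ≡⟨ contrapositive x x ⟨
      x ⇒ x              ∎

    ′⇒-absorb : ∀ x → x ′ ⇒ (x ⇒ x) ≡ x ⇒ x
    ′⇒-absorb x = begin
      x ′ ⇒ (x ⇒ x)      ≡⟨ cong (λ w → x ⊔ (w ⇒ x)) (invol x) ⟨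
      x ⊔ (x ′ ⊔ x)      ≡⟨ ⊔-absorb (x ′) x ⟩
      x ′ ⊔ x            ≡⟨ cong (_⇒ x) (invol x) ⟩
      x ⇒ x              ∎

    -- The image of `𝟜` generated by one element, and its collapse.

    module OneGenerated (x : Carrier) where

      eval : Bool × Bool → Carrier
      eval (false , false) = 𝟘
      eval (true  , false) = x
      eval (false , true)  = x ′
      eval (true  , true)  = x ⇒ x

      eval-⇒ : ∀ s t → eval (Zroupoid._⇒_ 𝟜 s t) ≡ eval s ⇒ eval t
      eval-⇒ (false , false) t = sym (trans (cong (_⇒ eval t) (sym 𝟘′≡𝟘)) (⊔-identityˡ (eval t)))
      eval-⇒ (true  , false) (false , false) = refl
      eval-⇒ (true  , false) (true  , false) = refl
      eval-⇒ (true  , false) (false , true)  = sym (trans (cong (_⇒ x ′) (sym (invol x))) (⊔-idem (x ′)))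
      eval-⇒ (true  , false) (true  , true)  = sym (⇒-absorbˡ x)
      eval-⇒ (false , true)  (false , false) = sym (invol x)
      eval-⇒ (false , true)  (true  , false) = sym (⊔-idem x)
      eval-⇒ (false , true)  (false , true)  = contrapositive x x
      eval-⇒ (false , true)  (true  , true)  = sym (′⇒-absorb x)
      eval-⇒ (true  , true)  (false , false) = sym (⇒-self-′ x)
      eval-⇒ (true  , true)  (true  , false) = sym (begin
        (x ⇒ x) ⇒ x        ≡⟨ contrapositive _ x ⟩
        x ′ ⇒ (x ⇒ x) ′    ≡⟨ cong (x ′ ⇒_) (⇒-self-′ x) ⟩
        x ′ ⇒ (x ⇒ x)      ≡⟨ ′⇒-absorb x ⟩
        x ⇒ x              ∎)
      eval-⇒ (true  , true)  (false , true)  = sym (begin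
        (x ⇒ x) ⇒ x ′      ≡⟨ ⇒-exchange _ x ⟩
        x ⇒ (x ⇒ x) ′      ≡⟨ cong (x ⇒_) (⇒-self-′ x) ⟩
        x ⇒ (x ⇒ x)        ≡⟨ ⇒-absorbˡ x ⟩
        x ⇒ x              ∎)
      eval-⇒ (true  , true)  (true  , true)  =
        sym (trans (cong (_⇒ (x ⇒ x)) (sym (⇒-self-′ x))) (⊔-idem (x ⇒ x)))

      -- Both `𝟘` and `x ⇒ x` are fixed by `′`; if either equals `x` or `x ′`, then `x` is fixed
      -- too.
      𝟘≡x⇒fixed : 𝟘 ≡ x → x ′ ≡ x
      𝟘≡x⇒fixed e = trans (cong _′ (sym e)) (trans 𝟘′≡𝟘 e)

      𝟘≡x′⇒fixed : 𝟘 ≡ x ′ → x ′ ≡ x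
      𝟘≡x′⇒fixed e = trans (sym e) (trans (sym 𝟘′≡𝟘) (trans (cong _′ e) (invol x)))

      x≡x⇒x⇒fixed : x ≡ x ⇒ x → x ′ ≡ x
      x≡x⇒x⇒fixed e = trans (cong _′ e) (trans (⇒-self-′ x) (sym e))

      x′≡x⇒x⇒fixed : x ′ ≡ x ⇒ x → x ′ ≡ x
      x′≡x⇒x⇒fixed e = trans e (trans (sym (⇒-self-′ x)) (trans (cong _′ (sym e)) (invol x)))

      -- Applying `x ⇒_` to the hypothesis and absorbing gives `x ′ ≡ x ⇒ x`, the previous case.
      𝟘≡x⇒x⇒fixed : 𝟘 ≡ x ⇒ x → x ′ ≡ x
      𝟘≡x⇒x⇒fixed e = x′≡x⇒x⇒fixed (trans (cong (x ⇒_) e) (⇒-absorbˡ x))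

      eval-collapse : ∀ s t → s ≢ t → eval s ≡ eval t → x ′ ≡ x
      eval-collapse (false , false) (false , false) s≢t _ = ⊥-elim (s≢t refl)
      eval-collapse (false , false) (true  , false) _   e = 𝟘≡x⇒fixed e
      eval-collapse (false , false) (false , true)  _   e = 𝟘≡x′⇒fixed e
      eval-collapse (false , false) (true  , true)  _   e = 𝟘≡x⇒x⇒fixed e
      eval-collapse (true  , false) (false , false) _   e = 𝟘≡x⇒fixed (sym e)
      eval-collapse (true  , false) (true  , false) s≢t _ = ⊥-elim (s≢t refl)
      eval-collapse (true  , false) (false , true)  _   e = sym e
      eval-collapse (true  , false) (true  , true)  _   e = x≡x⇒x⇒fixed e
      eval-collapse (false , true)  (false , false) _   e = 𝟘≡x′⇒fixed (sym e)
      eval-collapse (false , true)  (true  , false) _   e = e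
      eval-collapse (false , true)  (false , true)  s≢t _ = ⊥-elim (s≢t refl)
      eval-collapse (false , true)  (true  , true)  _   e = x′≡x⇒x⇒fixed e
      eval-collapse (true  , true)  (false , false) _   e = 𝟘≡x⇒x⇒fixed (sym e)
      eval-collapse (true  , true)  (true  , false) _   e = x≡x⇒x⇒fixed (sym e)
      eval-collapse (true  , true)  (false , true)  _   e = x′≡x⇒x⇒fixed (sym e)
      eval-collapse (true  , true)  (true  , true)  s≢t _ = ⊥-elim (s≢t refl)

    𝟜-refuted⇒′-fixed : ∀ {X i j} → Satisfies Z X i j → ∃ (Separates 𝟜 (X , i , j)) → ∀ x → x ′ ≡ x
    𝟜-refuted⇒′-fixed {X} {i} {j} sat ((p , q , r) , ne) x =
      eval-collapse _ _ ne (Homomorphism.identity-transfer 𝟜 Z eval eval-⇒ {X} {i} {j} sat p q r)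
      where open OneGenerated x

  ′-fixed⇒InSL : (∀ x → x ′ ≡ x) → InSL Z
  ′-fixed⇒InSL fixed = record
    { isI  = isI
    ; prim = fixed
    ; comm = λ x y → trans (contrapositive x y) (cong₂ _⇒_ (fixed y) (fixed x))
    }

refuted⇒InSL : ∀ {ℓ} {X i j} (Z : Zroupoid ℓ) →
  ∃ (Separates 𝟚 (X , i , j)) → ∃ (Separates 𝟜 (X , i , j)) → InS Z → Satisfies Z X i j → InSL Z
refuted⇒InSL {X = X} {i} {j} Z r₂ r₄ inS sat =
  -- The same identity is used twice: its failure in `𝟚` gives `𝟘 ′ ≡ 𝟘`, under which its failure in
  -- `𝟜` applies.
  ′-fixed⇒InSL (ZeroIsOne.𝟜-refuted⇒′-fixed (𝟚-refuted⇒𝟘′≡𝟘 {X} {i} {j} sat r₂) {X} {i} {j} sat r₄)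
  where open Symmetric Z inS

-- The converse: associativity in SL.

module Semilattice {ℓ : Level} (Z : Zroupoid ℓ) (inSL : InSL Z) where
  open Zroupoid Z
  open InSL inSL
  open IsIZroupoid isI

  inS : InS Z
  inS = record
    { isI   = isI
    ; invol = λ x → trans (prim _) (prim x)
    ; symm  = λ x y → cong _′ (trans (cong (x ⇒_) (prim y)) (trans (comm x y) (cong (y ⇒_) (sym (prim x)))))
    }

  -- This is `axI` with every `′` erased by `prim`.
  ⇒-distribʳ : ∀ x y z → (x ⇒ y) ⇒ z ≡ (x ⇒ z) ⇒ (y ⇒ z)
  ⇒-distribʳ x y z = begin
    (x ⇒ y) ⇒ z                          ≡⟨ axI x y z ⟩
    (((z ′) ⇒ x) ⇒ ((y ⇒ z) ′)) ′        ≡⟨ prim _ ⟩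
    ((z ′) ⇒ x) ⇒ ((y ⇒ z) ′)            ≡⟨ cong₂ _⇒_ (trans (cong (_⇒ x) (prim z)) (comm z x)) (prim _) ⟩
    (x ⇒ z) ⇒ (y ⇒ z)                    ∎

  ⇒-distribˡ : ∀ x y z → x ⇒ (y ⇒ z) ≡ (x ⇒ y) ⇒ (x ⇒ z)
  ⇒-distribˡ x y z = trans (comm x _) (trans (⇒-distribʳ y z x) (cong₂ _⇒_ (comm y x) (comm z x)))

  ⇒-identityˡ : ∀ x → 𝟘 ⇒ x ≡ x
  ⇒-identityˡ x = trans (comm 𝟘 x) (prim x)

  ⇒-idem : ∀ x → x ⇒ x ≡ x
  ⇒-idem x = begin
    x ⇒ x                ≡⟨ cong₂ _⇒_ (⇒-identityˡ x) (⇒-identityˡ x) ⟨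
    (𝟘 ⇒ x) ⇒ (𝟘 ⇒ x)    ≡⟨ ⇒-distribʳ 𝟘 𝟘 x ⟨
    (𝟘 ⇒ 𝟘) ⇒ x          ≡⟨ cong (_⇒ x) (prim 𝟘) ⟩
    𝟘 ⇒ x                ≡⟨ ⇒-identityˡ x ⟩
    x                    ∎

  infix 4 _⊑_

  -- The semilattice order with `⇒` as meet. It is introduced so that associativity can follow from
  -- uniqueness of greatest lower bounds.
  _⊑_ : Carrier → Carrier → Set ℓ
  x ⊑ y = x ⇒ y ≡ x

  ⊑-trans : ∀ {x y z} → x ⊑ y → y ⊑ z → x ⊑ z
  ⊑-trans {x} {y} {z} x⊑y y⊑z = sym (begin
    x                    ≡⟨ x⊑y ⟨
    x ⇒ y                ≡⟨ cong (x ⇒_) y⊑z ⟨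
    x ⇒ (y ⇒ z)          ≡⟨ ⇒-distribˡ x y z ⟩
    -- Writing `x` as `x ⇒ 𝟘` restores a common left factor, so distributivity can be undone.
    (x ⇒ y) ⇒ (x ⇒ z)    ≡⟨ cong (_⇒ (x ⇒ z)) (trans x⊑y (sym (prim x))) ⟩
    (x ⇒ 𝟘) ⇒ (x ⇒ z)    ≡⟨ ⇒-distribˡ x 𝟘 z ⟨
    x ⇒ (𝟘 ⇒ z)          ≡⟨ cong (x ⇒_) (⇒-identityˡ z) ⟩
    x ⇒ z                ∎)

  ⊑-antisym : ∀ {x y} → x ⊑ y → y ⊑ x → x ≡ y
  ⊑-antisym x⊑y y⊑x = trans (sym x⊑y) (trans (comm _ _) y⊑x)

  ⇒-lowerʳ : ∀ x y → x ⇒ y ⊑ y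
  ⇒-lowerʳ x y = begin
    (x ⇒ y) ⇒ y          ≡⟨ cong ((x ⇒ y) ⇒_) (⇒-identityˡ y) ⟨
    (x ⇒ y) ⇒ (𝟘 ⇒ y)    ≡⟨ ⇒-distribʳ x 𝟘 y ⟨
    (x ⇒ 𝟘) ⇒ y          ≡⟨ cong (_⇒ y) (prim x) ⟩
    x ⇒ y                ∎

  ⇒-lowerˡ : ∀ x y → x ⇒ y ⊑ x
  ⇒-lowerˡ x y = trans (cong (_⇒ x) (comm x y)) (trans (⇒-lowerʳ y x) (comm y x))

  ⇒-greatest : ∀ {w x y} → w ⊑ x → w ⊑ y → w ⊑ x ⇒ y
  ⇒-greatest {w} {x} {y} w⊑x w⊑y =
    trans (⇒-distribˡ w x y) (trans (cong₂ _⇒_ w⊑x w⊑y) (⇒-idem w))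

  -- Each side is a greatest lower bound of `x`, `y` and `z`, so each lies below the other.
  ⇒-assoc : ∀ x y z → (x ⇒ y) ⇒ z ≡ x ⇒ (y ⇒ z)
  ⇒-assoc x y z = ⊑-antisym
    (⇒-greatest (⊑-trans (⇒-lowerˡ _ z) (⇒-lowerˡ x y))
                (⇒-greatest (⊑-trans (⇒-lowerˡ _ z) (⇒-lowerʳ x y)) (⇒-lowerʳ _ z)))
    (⇒-greatest (⇒-greatest (⇒-lowerˡ x _) (⊑-trans (⇒-lowerʳ x _) (⇒-lowerˡ y z)))
                (⊑-trans (⇒-lowerʳ x _) (⇒-lowerʳ y z)))

  -- The right-nested bracketing serves as normal form, so any two bracketings agree.
  bracket≡b1 : ∀ i p q r s → bracket Z i p q r s ≡ bracket Z b1 p q r s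
  bracket≡b1 b1 p q r s = refl
  bracket≡b1 b2 p q r s = cong (p ⇒_) (⇒-assoc q r s)
  bracket≡b1 b3 p q r s = ⇒-assoc p q (r ⇒ s)
  bracket≡b1 b4 p q r s = trans (⇒-assoc p (q ⇒ r) s) (bracket≡b1 b2 p q r s)
  bracket≡b1 b5 p q r s = trans (⇒-assoc (p ⇒ q) r s) (bracket≡b1 b3 p q r s)

  term≡b1 : ∀ X i x y z → term Z X i x y z ≡ term Z X b1 x y z
  term≡b1 A i x y z = bracket≡b1 i x x y z
  term≡b1 B i x y z = bracket≡b1 i x y x z
  term≡b1 C i x y z = bracket≡b1 i x y y z
  term≡b1 D i x y z = bracket≡b1 i x y z x
  term≡b1 E i x y z = bracket≡b1 i x y z y
  term≡b1 F i x y z = bracket≡b1 i x y z z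

  satisfies : ∀ X i j → Satisfies Z X i j
  satisfies X i j x y z = trans (term≡b1 X i x y z) (sym (term≡b1 X j x y z))

theorem3p7 : ∀ {ℓ : Level} (X : Letter) (i j : Br) → (X , i , j) ∈ theorem3p7-list →
    (Z : Zroupoid ℓ) → (InS Z × Satisfies Z X i j) ⇔ InSL Z
theorem3p7 X i j m Z = mk⇔
  (λ { (inS , sat) → refuted⇒InSL {X = X} {i} {j} Z
         (satisfied (lookup all-refuted-𝟚 m)) (satisfied (lookup all-refuted-𝟜 m)) inS sat })
  (λ inSL → let open Semilattice Z inSL in inS , satisfies X i j)
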